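{- Let $\ell\ge 3$ and let $H$ be an $\ell$-layered acyclic oriented graph with $p(H)\ge 6$. Then $\tau(H)=p(H)$.
   Context: An oriented graph is a directed graph with no loops in which any two vertices are joined by at most one arc; a tournament is an orientation of a complete graph. An acyclic oriented graph $H$ is $\ell$-layered if for every vertex $v$ of $H$ that is neither a sink nor a source there is a pair $(i,j)\in\mathbb Z_\ell^2$ such that the length of every directed path from any source of $H$ to $v$ is congruent to $i$ modulo $\ell$ and the length of every directed path from $v$ to any sink of $H$ is congruent to $j$ modulo $\ell$. A homomorphism $H\to T$ is a map $f:V(H)\to V(T)$ such that $f(u)f(v)$ is an arc of $T$ for every arc $uv$ of $H$. The compressibility $\tau(H)$ is the smallest $k\in\mathbb N$ such that for every tournament $T$ on $k$ vertices there is a homomorphism $H\to T$ ($\infty$ if none exists). $p(H)$ is the maximum number of vertices of a directed path in $H$. -}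

module Defs where

open import Data.Nat using (ℕ; zero; suc; _+_; _*_; _≤_; _<_)
open import Data.Fin using (Fin; toℕ)
open import Data.Bool using (Bool; true; false)
open import Data.List using (List; []; _∷_)
open import Data.List.Relation.Unary.Unique.Propositional using (Unique)
open import Data.Product using (Σ; ∃; _×_; _,_)
open import Data.Sum using (_⊎_)
open import Relation.Nullary using (¬_)
open import Relation.Binary.PropositionalEquality using (_≡_; _≢_)

record OrientedGraph (n : ℕ) : Set where
  field
    adj     : Fin n → Fin n → Bool
    noLoop  : ∀ v → adj v v ≡ false
    antisym : ∀ u v → adj u v ≡ true → adj v u ≡ false

open OrientedGraph public

Arc : ∀ {n} → OrientedGraph n → Fin n → Fin n → Set
Arc G u v = adj G u v ≡ true

IsTournament : ∀ {k} → OrientedGraph k → Set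
IsTournament T = ∀ u v → u ≢ v → Arc T u v ⊎ Arc T v u

data Walk {n} (G : OrientedGraph n) : Fin n → Fin n → ℕ → Set where
  here : ∀ {v} → Walk G v v 0
  step : ∀ {u w v m} → Arc G u w → Walk G w v m → Walk G u v (suc m)

vertices : ∀ {n} {G : OrientedGraph n} {u v m} → Walk G u v m → List (Fin n)
vertices {v = v} here = v ∷ []
vertices {u = u} (step _ w) = u ∷ vertices w

record DPath {n} (G : OrientedGraph n) (u v : Fin n) (m : ℕ) : Set where
  field
    walk     : Walk G u v m
    distinct : Unique (vertices walk)

Acyclic : ∀ {n} → OrientedGraph n → Set
Acyclic G = ∀ v m → ¬ Walk G v v (suc m)

IsSource : ∀ {n} → OrientedGraph n → Fin n → Set
IsSource G v = ∀ u → ¬ Arc G u v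

IsSink : ∀ {n} → OrientedGraph n → Fin n → Set
IsSink G v = ∀ u → ¬ Arc G v u

CongMod : (ℓ : ℕ) → ℕ → Fin ℓ → Set
CongMod ℓ m i = ∃ λ q → m ≡ toℕ i + q * ℓ

Layered : ∀ {n} → ℕ → OrientedGraph n → Set
Layered {n} ℓ G =
  ∀ v → ¬ IsSource G v → ¬ IsSink G v →
  Σ (Fin ℓ) λ i → Σ (Fin ℓ) λ j →
    (∀ s m → IsSource G s → DPath G s v m → CongMod ℓ m i) ×
    (∀ t m → IsSink G t → DPath G v t m → CongMod ℓ m j)

IsHom : ∀ {n k} → OrientedGraph n → OrientedGraph k → (Fin n → Fin k) → Set
IsHom H T f = ∀ u v → Arc H u v → Arc T (f u) (f v)

AllTournamentsReceive : ∀ {n} → OrientedGraph n → ℕ → Set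
AllTournamentsReceive H k =
  (T : OrientedGraph k) → IsTournament T → ∃ λ f → IsHom H T f

IsCompressibility : ∀ {n} → OrientedGraph n → ℕ → Set
IsCompressibility H k =
  AllTournamentsReceive H k × (∀ k′ → k′ < k → ¬ AllTournamentsReceive H k′)

IsMaxPathOrder : ∀ {n} → OrientedGraph n → ℕ → Set
IsMaxPathOrder H p =
  (∃ λ u → ∃ λ v → ∃ λ m → DPath H u v m × suc m ≡ p) ×
  (∀ u v m → DPath H u v m → suc m ≤ p)

{-# OPTIONS --safe #-}
-- Lower bound: a walk of H maps strictly increasingly into a transitive tournament.
--
-- Upper bound: an inner vertex of H (neither source nor sink) is placed by its depth, the
-- length of a longest walk ending there. Being ℓ-layered makes the depth grow by 1 modulo ℓ
-- along arcs into inner vertices, and makes depth + height constant modulo ℓ along arcs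
-- between inner vertices. So it suffices to find an arc a → b of T and, for each residue r,
-- a sequence w from a whose members at positions i < j with j ≡ i + 1 (mod ℓ) are joined by
-- arcs and which can step to b at the positions ≡ r - 1; sources go to a and sinks to b.
--
-- Enlarging a cycle one vertex at a time, as long as a vertex or a back arc allows it, shows
-- that the vertices of a tournament either contain a cycle of a prescribed length N ≥ 3 or
-- split as A ⇒ D ⇒ B with A ⇒ B, where D is a path on fewer than N vertices. With N = ℓ
-- this gives, by recursion on A and B, a sequence as above on as many positions as the
-- tournament has vertices: walk around an ℓ-cycle, or concatenate. With N = 6 there are two
-- cases. If T splits, it does so into two nonempty parts X ⇒ Y, and a prefix of the sequence
-- of X followed by a suffix of that of Y has any length wanted; a and b are its ends. If T
-- has a 6-cycle, then the six vertices contain a → b together with, for all ℓ ≥ 3 and r,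
-- a closed walk of length ℓ entered from a and left to b at the right moment: for
-- ℓ = 3, 4, 5 this is checked for all 2⁹ orientations of the chords, and inserting triangles
-- gives all larger ℓ.
module Submission where

open import Defs
open import Data.Nat using (ℕ; _≤_)
open import Data.Nat using (zero; suc; _+_; _*_; _∸_; _<_; _<ᵇ_; _/_; _%_;
  _≤?_; _<?_; z≤n; s≤s; z<s; NonZero)
open import Data.Nat.Properties hiding (_≟_)
open import Data.Nat.DivMod
open import Data.Nat.Induction using (<-wellFounded)
open import Data.Nat.Tactic.RingSolver using (solve-∀)
open import Data.Bool as Bool using (Bool; true; false; not)
open import Data.Bool.Properties using (T-≡)
open import Data.Empty using (⊥)
open import Data.Fin as Fin using (Fin; toℕ)
open import Data.Fin.Patterns
open import Data.Fin.Properties using (any?; all?; toℕ<n; toℕ-injective)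
open import Data.List using (List; []; _∷_; _++_; length; allFin)
open import Data.List.Properties using (length-++; length-tabulate)
open import Data.List.Membership.Propositional using (_∈_; find; lose)
open import Data.List.Membership.Propositional.Properties using (∈-++⁺ˡ; ∈-++⁺ʳ; ∈-++⁻; ∈-∃++)
open import Data.List.Relation.Unary.All as All using (All; []; _∷_)
open import Data.List.Relation.Unary.AllPairs using ([]; _∷_)
open import Data.List.Relation.Unary.Any as Any using (here; there)
open import Data.List.Relation.Unary.Unique.Propositional using (Unique)
open import Data.List.Relation.Unary.Unique.Propositional.Properties using (allFin⁺)
open import Data.List.Relation.Binary.Permutation.Propositional
open import Data.List.Relation.Binary.Permutation.Propositional.Properties
import Data.List.Relation.Binary.Permutation.Setoid.Properties as Permutation
open import Data.Product using (∃; Σ; _×_; _,_; proj₁; proj₂)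
open import Data.Sum using (_⊎_; inj₁; inj₂; [_,_]′)
open import Data.Vec using (Vec; []; _∷_; lookup)
open import Function using (_∘_; case_of_; id; module Equivalence)
open import Induction.WellFounded using (Acc; acc)
open import Level using (0ℓ)
open import Relation.Binary using (tri<; tri≈; tri>)
open import Relation.Binary.PropositionalEquality as ≡ using (_≡_; _≢_; refl; cong; subst)
open import Relation.Nullary using (¬_; ¬?; Dec; yes; no; contradiction)
open import Relation.Nullary.Decidable using (_×-dec_; map′; from-yes; dec-true; dec-false)
open import Relation.Unary using (Pred; Decidable)

-- Lists without repetitions and permutations.

private
  variable
    A : Set

Unique-resp-↭ : {xs ys : List A} → xs ↭ ys → Unique xs → Unique ys
Unique-resp-↭ σ = Permutation.Unique-resp-↭ (≡.setoid _) (↭⇒↭ₛ σ)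

++-disjoint : ∀ {x y : A} xs {ys} → Unique (xs ++ ys) → x ∈ xs → y ∈ ys → x ≢ y
++-disjoint (_ ∷ xs) (x∉ ∷ _) (here refl) y∈ refl = All.lookup x∉ (∈-++⁺ʳ xs y∈) refl
++-disjoint (_ ∷ xs) (_ ∷ u)  (there x∈)  y∈      = ++-disjoint xs u x∈ y∈

++-uniqueˡ : ∀ (xs : List A) {ys} → Unique (xs ++ ys) → Unique xs
++-uniqueˡ []       _        = []
++-uniqueˡ (_ ∷ xs) (x∉ ∷ u) =
  All.tabulate (All.lookup x∉ ∘ ∈-++⁺ˡ) ∷ ++-uniqueˡ xs u

++-uniqueʳ : ∀ (xs : List A) {ys} → Unique (xs ++ ys) → Unique ys
++-uniqueʳ []       u       = u
++-uniqueʳ (_ ∷ xs) (_ ∷ u) = ++-uniqueʳ xs u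

extract : ∀ {x : A} {xs} → x ∈ xs → ∃ λ ys → xs ↭ x ∷ ys
extract x∈ with ys , zs , refl ← ∈-∃++ x∈ = ys ++ zs , shift _ ys zs

-- Serves to sort the vertices outside a cycle: `E` for those that can be inserted, `P` for those
-- dominating it, `Q` for those dominated by it.
classify : ∀ {E P Q : A → Set} ys → (∀ {y} → y ∈ ys → E y ⊎ P y ⊎ Q y) →
  (∃ λ y → ∃ λ zs → E y × ys ↭ y ∷ zs) ⊎
  (∃ λ as → ∃ λ bs → All P as × All Q bs × ys ↭ as ++ bs)
classify []       f = inj₂ ([] , [] , [] , [] , refl)
classify (y ∷ ys) f with f (here refl) | classify ys (f ∘ there)
... | inj₁ e        | _ = inj₁ (y , ys , e , refl)
... | inj₂ _        | inj₁ (z , zs , e , σ) =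
  inj₁ (z , y ∷ zs , e , ↭-trans (prep y σ) (swap y z refl))
... | inj₂ (inj₁ p) | inj₂ (as , bs , ps , qs , σ) =
  inj₂ (y ∷ as , bs , p ∷ ps , qs , prep y σ)
... | inj₂ (inj₂ q) | inj₂ (as , bs , ps , qs , σ) =
  inj₂ (as , y ∷ bs , ps , q ∷ qs , ↭-trans (prep y σ) (↭-sym (shift y as bs)))

-- Walks in an oriented graph.

module _ {n} {G : OrientedGraph n} where

  at : ∀ {u v m} → Walk G u v m → ℕ → Fin n
  at {v = v} here       _       = v
  at {u = u} (step _ w) zero    = u
  at         (step _ w) (suc i) = at w i

  at-first : ∀ {u v m} (w : Walk G u v m) → at w 0 ≡ u
  at-first here       = refl
  at-first (step _ _) = refl

  at-last : ∀ {u v m} (w : Walk G u v m) → at w m ≡ v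
  at-last here       = refl
  at-last (step _ w) = at-last w

  at-arc : ∀ {u v m} (w : Walk G u v m) {i} → i < m → Arc G (at w i) (at w (suc i))
  at-arc (step a w) {zero}  _       = subst (Arc G _) (≡.sym (at-first w)) a
  at-arc (step _ w) {suc i} (s≤s p) = at-arc w p

  first∈ : ∀ {u v m} (w : Walk G u v m) → u ∈ vertices w
  first∈ here       = here refl
  first∈ (step _ _) = here refl

  at∈ : ∀ {u v m} (w : Walk G u v m) i → at w i ∈ vertices w
  at∈ here       _       = here refl
  at∈ (step _ _) zero    = here refl
  at∈ (step _ w) (suc i) = there (at∈ w i)

  last∈ : ∀ {u v m} (w : Walk G u v m) → v ∈ vertices w
  last∈ here       = here refl
  last∈ (step _ w) = there (last∈ w)

  length-vertices : ∀ {u v m} (w : Walk G u v m) → length (vertices w) ≡ suc m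
  length-vertices here       = refl
  length-vertices (step _ w) = cong suc (length-vertices w)

  infixr 5 _++ʷ_
  _++ʷ_ : ∀ {u v x m n} → Walk G u v m → Walk G v x n → Walk G u x (m + n)
  here     ++ʷ w = w
  step a v ++ʷ w = step a (v ++ʷ w)

  snoc : ∀ {u v x m} → Walk G u v m → Arc G v x → Walk G u x (suc m)
  snoc here       b = step b here
  snoc (step a w) b = step a (snoc w b)

  at-join : ∀ {u v x m m′} (w : Walk G u v m) (w′ : Walk G v x m′) → at (w ++ʷ w′) m ≡ v
  at-join here       w′ = at-first w′
  at-join (step _ w) w′ = at-join w w′

  snoc∈ : ∀ {u v x y m} (w : Walk G u v m) (a : Arc G v x) →
    y ∈ vertices (snoc w a) → y ∈ vertices w ⊎ y ≡ x
  snoc∈ here       a (here refl)         = inj₁ (here refl)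
  snoc∈ here       a (there (here refl)) = inj₂ refl
  snoc∈ (step _ w) a (here refl)         = inj₁ (here refl)
  snoc∈ (step _ w) a (there y∈) with snoc∈ w a y∈
  ... | inj₁ y∈w = inj₁ (there y∈w)
  ... | inj₂ eq  = inj₂ eq

  walk-to : ∀ {u v x m} (w : Walk G u v m) → x ∈ vertices w → ∃ (Walk G u x)
  walk-to here       (here refl) = 0 , here
  walk-to (step _ _) (here refl) = 0 , here
  walk-to (step a w) (there x∈)  = let m , w′ = walk-to w x∈ in suc m , step a w′

  -- A later return to the first vertex would give a closed walk. Hence every walk counts as a
  -- directed path, to which the bound `p` and the layering apply.
  distinct-vertices : Acyclic G → ∀ {u v m} (w : Walk G u v m) → Unique (vertices w)
  distinct-vertices acyclic here = [] ∷ []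
  distinct-vertices acyclic (step {u} a w) =
    All.tabulate (λ { x∈ refl → let m , w′ = walk-to w x∈ in acyclic u m (step a w′) }) ∷
    distinct-vertices acyclic w

  dpath : Acyclic G → ∀ {u v m} → Walk G u v m → DPath G u v m
  dpath acyclic w = record { walk = w ; distinct = distinct-vertices acyclic w }

  walk? : ∀ u v m → Dec (Walk G u v m)
  walk? u v zero    = map′ (λ { refl → here }) (λ { here → refl }) (u Fin.≟ v)
  walk? u v (suc m) = map′ (λ { (x , a , w) → step a w }) (λ { (step a w) → _ , a , w })
    (any? λ x → (adj G u x Bool.≟ true) ×-dec walk? x v m)

-- Maxima and congruent lengths.

maximum : ∀ {P : ℕ → Set} → Decidable P → P 0 → ∀ N →
  ∃ λ m → P m × (∀ {i} → i ≤ N → P i → i ≤ m)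
maximum P? p₀ zero = 0 , p₀ , λ i≤0 _ → i≤0
maximum P? p₀ (suc N) with P? (suc N)
... | yes p = suc N , p , λ i≤N _ → i≤N
... | no ¬p with maximum P? p₀ N
... | m , p , max = m , p , λ {i} i≤sN q →
  [ (λ i<sN → max (≤-pred i<sN) q) , (λ { refl → contradiction q ¬p }) ]′ (m≤n⇒m<n∨m≡n i≤sN)

distribute : ∀ a b c d → a + (b + c) * d ≡ a + b * d + c * d
distribute = solve-∀

CongMod-diff : ∀ {ℓ m n} {i : Fin ℓ} → CongMod ℓ m i → CongMod ℓ n i → m ≤ n →
  ∃ λ q → n ≡ m + q * ℓ
CongMod-diff {ℓ} {m} {n} {i} (p , refl) (q , refl) m≤n with p ≤? q
... | yes p≤q = q ∸ p , (begin
  toℕ i + q * ℓ                  ≡⟨ cong (λ t → toℕ i + t * ℓ) (m+[n∸m]≡n p≤q) ⟨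
  toℕ i + (p + (q ∸ p)) * ℓ      ≡⟨ distribute (toℕ i) p (q ∸ p) ℓ ⟩
  toℕ i + p * ℓ + (q ∸ p) * ℓ    ∎)
  where open ≡.≡-Reasoning
-- A larger quotient for `m` forces `n ≤ m`, hence `m ≡ n`.
... | no  p≰q = 0 , ≡.trans
  (≤-antisym (+-monoʳ-≤ (toℕ i) (*-monoˡ-≤ ℓ (<⇒≤ (≰⇒> p≰q)))) m≤n) (≡.sym (+-identityʳ _))

-- Exhaustive search on strong tournaments with six vertices.

Matrix = Fin 6 → Fin 6 → Bool

-- The 6-cycle 0 → 1 → … → 5 → 0 with each of its nine chords oriented by one bit.
matrix : Vec Bool 9 → Matrix
matrix (a ∷ b ∷ c ∷ d ∷ e ∷ f ∷ g ∷ h ∷ i ∷ []) u v = lookup (lookup rows u) v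
  where
  O I : Bool
  O = false
  I = true
  rows : Vec (Vec Bool 6) 6
  rows = (O     ∷ I     ∷ a     ∷ b     ∷ c     ∷ O ∷ [])
       ∷ (O     ∷ O     ∷ I     ∷ d     ∷ e     ∷ f ∷ [])
       ∷ (not a ∷ O     ∷ O     ∷ I     ∷ g     ∷ h ∷ [])
       ∷ (not b ∷ not d ∷ O     ∷ O     ∷ I     ∷ i ∷ [])
       ∷ (not c ∷ not e ∷ not g ∷ O     ∷ O     ∷ I ∷ [])
       ∷ (I     ∷ not f ∷ not h ∷ not i ∷ O     ∷ O ∷ [])
       ∷ []

module _ (M : Matrix) where
  Reach : ℕ → Pred (Fin 6) 0ℓ → Pred (Fin 6) 0ℓ
  Reach zero    Q u = Q u
  Reach (suc n) Q u = ∃ λ v → M u v ≡ true × Reach n Q v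

  reach? : ∀ n {Q} → Decidable Q → Decidable (Reach n Q)
  reach? zero    Q? u = Q? u
  reach? (suc n) Q? u = any? λ v → (M u v Bool.≟ true) ×-dec reach? n Q? v

  -- A closed walk from x of length d + e, entered from a at x and left to b after d steps.
  Linked : Fin 6 → Fin 6 → ℕ × ℕ → Set
  Linked a b (d , e) =
    ∃ λ x → M a x ≡ true × Reach d (λ y → M y b ≡ true × Reach e (x ≡_) y) x

  linked? : ∀ a b → Decidable (Linked a b)
  linked? a b (d , e) = any? λ x → (M a x Bool.≟ true) ×-dec
    reach? d (λ y → (M y b Bool.≟ true) ×-dec reach? e (x Fin.≟_) y) x

  -- All (d , e) with e ≥ 1 and d + e ∈ {3, 4, 5}. A triangle through x lengthens either
  -- of the walks x → y and y → x by 3, so these settle all d + e ≥ 3.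
  lengths : List (ℕ × ℕ)
  lengths = (0 , 3) ∷ (1 , 2) ∷ (2 , 1)
          ∷ (0 , 4) ∷ (1 , 3) ∷ (2 , 2) ∷ (3 , 1)
          ∷ (0 , 5) ∷ (1 , 4) ∷ (2 , 3) ∷ (3 , 2) ∷ (4 , 1) ∷ []

  -- The closed walks of length 3 are the triangles used for lengthening; every vertex of a strong
  -- tournament on at least three vertices lies on one.
  Gadget : Set
  Gadget = (∀ x → Reach 3 (x ≡_) x) ×
    ∃ λ a → ∃ λ b → M a b ≡ true × All (Linked a b) lengths

  gadget? : Dec Gadget
  gadget? = all? (λ x → reach? 3 (x Fin.≟_) x) ×-dec
    any? λ a → any? λ b → (M a b Bool.≟ true) ×-dec All.all? (linked? a b) lengths

allBits? : ∀ {n} {P : Vec Bool n → Set} → Decidable P → Dec (∀ bs → P bs)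
allBits? {zero} P? = map′ (λ { p [] → p }) (λ f → f []) (P? [])
allBits? {suc n} P? =
  map′ (λ { (p , q) (false ∷ bs) → p bs ; (p , q) (true ∷ bs) → q bs })
       (λ f → (λ bs → f (false ∷ bs)) , (λ bs → f (true ∷ bs)))
       (allBits? (λ bs → P? (false ∷ bs)) ×-dec allBits? (λ bs → P? (true ∷ bs)))

-- Abstract, lest the exhaustive search be unfolded again wherever it is used.
abstract
  gadget : ∀ chords → Gadget (matrix chords)
  gadget = from-yes (allBits? λ chords → gadget? (matrix chords))

-- Cycles and splits of a tournament.

module Tournament {k} (T : OrientedGraph k) (tournament : IsTournament T) where

  private
    V : Set
    V = Fin k

  infix 4 _⟶_ _⇒_
  _⟶_ : V → V → Set
  _⟶_ = Arc T

  _⟶?_ : ∀ u v → Dec (u ⟶ v)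
  u ⟶? v = adj T u v Bool.≟ true

  irrefl : ∀ {v} → ¬ v ⟶ v
  irrefl {v} a = case ≡.trans (≡.sym a) (noLoop T v) of λ ()

  _⇒_ : List V → List V → Set
  us ⇒ vs = ∀ {u v} → u ∈ us → v ∈ vs → u ⟶ v

  -- There are `suc m` vertices on the cycle. Their distinctness comes from outside, from `support`
  -- being part of a list without repetitions.
  record Cycle (m : ℕ) : Set where
    constructor cycle
    field
      {first last} : V
      path    : Walk T first last m
      closing : last ⟶ first
    support : List V
    support = vertices path
  open Cycle using (path; closing; support)

  data Insertion (y : V) {x z m} (w : Walk T x z m) : Set where
    inserted : (w′ : Walk T x z (suc m)) → vertices w′ ↭ y ∷ vertices w → Insertion y w
    ends     : y ⟶ x → z ⟶ y → Insertion y w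
    source   : All (y ⟶_) (vertices w) → Insertion y w
    sink     : All (_⟶ y) (vertices w) → Insertion y w

  -- If no vertex of the path that dominates `y` is followed by one that `y` dominates, then the
  -- vertices dominated by `y` form an initial segment: everything, nothing, or a proper part. In
  -- the last case `y` fits between the two ends once the path is closed to a cycle.
  insertion : ∀ {x z m} y (w : Walk T x z m) → All (y ≢_) (vertices w) → Insertion y w
  insertion y (here {v}) (y≢v ∷ []) with tournament y v y≢v
  ... | inj₁ y→v = source (y→v ∷ [])
  ... | inj₂ v→y = sink (v→y ∷ [])
  insertion y (step {u} u→x w) (y≢u ∷ y∉) with tournament y u y≢u | insertion y w y∉
  ... | _        | inserted w′ σ  =
    inserted (step u→x w′) (↭-trans (prep u σ) (swap u y refl))
  ... | inj₁ y→u | ends _ z→y     = ends y→u z→y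
  ... | inj₁ y→u | source y→w    = source (y→u ∷ y→w)
  ... | inj₁ y→u | sink w→y      = ends y→u (All.lookup w→y (last∈ w))
  ... | inj₂ u→y | ends y→x _     = inserted (step u→y (step y→x w)) (swap u y refl)
  ... | inj₂ u→y | source y→w    =
    inserted (step u→y (step (All.lookup y→w (first∈ w)) w)) (swap u y refl)
  ... | inj₂ u→y | sink w→y      = sink (u→y ∷ w→y)

  enlarge : ∀ {m} (c : Cycle m) y → All (y ≢_) (support c) →
    (∃ λ (c′ : Cycle (suc m)) → support c′ ↭ y ∷ support c) ⊎
    All (y ⟶_) (support c) ⊎ All (_⟶ y) (support c)
  enlarge (cycle w z→x) y y∉ with insertion y w y∉
  ... | inserted w′ σ = inj₁ (cycle w′ z→x , σ)
  ... | ends y→x z→y  = inj₁ (cycle (step y→x w) z→y , refl)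
  ... | source y→w    = inj₂ (inj₁ y→w)
  ... | sink w→y      = inj₂ (inj₂ w→y)

  orient : ∀ as {bs} → Unique (as ++ bs) →
    (as ⇒ bs) ⊎
    ∃ λ a → ∃ λ b → ∃ λ as′ → ∃ λ bs′ → b ⟶ a × a ∈ as × b ∈ bs × as ↭ a ∷ as′ × bs ↭ b ∷ bs′
  orient as {bs} distinct with Any.any? (λ a → Any.any? (_⟶? a) bs) as
  ... | no  none  = inj₁ λ {u} {v} u∈ v∈ →
    [ (λ u→v → u→v) , (λ v→u → contradiction (lose u∈ (lose v∈ v→u)) none) ]′
    (tournament u v (++-disjoint as distinct u∈ v∈))
  ... | yes found with a , a∈ , found′ ← find found
                  with b , b∈ , b→a ← find found′ =
    inj₂ (a , b , proj₁ (extract a∈) , proj₁ (extract b∈)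
         , b→a , a∈ , b∈ , proj₂ (extract a∈) , proj₂ (extract b∈))

  record Split (N : ℕ) (xs : List V) : Set where
    constructor split
    field
      {above below} : List V
      {start end} : V
      {size} : ℕ
      middle : Walk T start end size
      short  : suc size < N
      covers : above ++ vertices middle ++ below ↭ xs
      above⇒middle : above ⇒ vertices middle
      middle⇒below : vertices middle ⇒ below
      above⇒below  : above ⇒ below

  CycleIn : ℕ → List V → Set
  CycleIn N xs = ∃ λ m → Σ (Cycle m) λ c → suc m ≡ N × ∃ λ ys → support c ++ ys ↭ xs

  module _ {N : ℕ} {xs : List V} (distinct : Unique xs) where

    -- A vertex that neither dominates nor is dominated by the cycle fits into it. A back
    -- arc b → a enlarges it too: a and b replace its first vertex.
    grow : ∀ fuel {m} → fuel + suc m ≡ N → (c : Cycle m) → ∀ ys → support c ++ ys ↭ xs →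
      CycleIn N xs ⊎ Split N xs
    -- `fuel` counts the vertices that the cycle still lacks.
    grow zero       eq c ys σ = inj₁ (_ , c , eq , ys , σ)
    grow (suc fuel) {m} eq c ys σ with classify ys (λ {y} y∈ → enlarge c y
      (All.tabulate λ v∈ y≡v →
        ++-disjoint (support c) (Unique-resp-↭ (↭-sym σ) distinct) v∈ y∈ (≡.sym y≡v)))
    ... | inj₁ (y , zs , (c′ , τ) , ρ) = grow fuel (≡.trans (+-suc fuel (suc m)) eq) c′ zs
      (↭-trans (++⁺ʳ zs τ) (↭-trans (↭-sym (shift y (support c) zs))
        (↭-trans (++⁺ˡ (support c) (↭-sym ρ)) σ)))
    ... | inj₂ (as , bs , as→c , c→bs , ρ)
      with orient as (Unique-resp-↭ ρ (++-uniqueʳ (support c) (Unique-resp-↭ (↭-sym σ) distinct)))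
    ... | inj₁ as⇒bs = inj₂ (split (path c)
      (subst (suc (suc m) ≤_) eq (s≤s (m≤n+m (suc m) fuel)))
      (↭-trans (shifts as (support c)) (↭-trans (++⁺ˡ (support c) (↭-sym ρ)) σ))
      (λ u∈ v∈ → All.lookup (All.lookup as→c u∈) v∈)
      (λ u∈ v∈ → All.lookup (All.lookup c→bs v∈) u∈)
      as⇒bs)
    ... | inj₂ (a , b , as′ , bs′ , b→a , a∈ , b∈ , τ , υ) with c
    ... | cycle here x→x = contradiction x→x irrefl
    ... | cycle (step {x} _ w) _ = grow fuel (≡.trans (+-suc fuel (suc m)) eq)
      (cycle (step b→a (step (All.lookup (All.lookup as→c a∈) (there (first∈ w))) w))
             (All.lookup (All.lookup c→bs b∈) (there (last∈ w))))
      (x ∷ as′ ++ bs′) (↭-trans perm σ)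
      where
      open PermutationReasoning
      perm : b ∷ a ∷ vertices w ++ x ∷ as′ ++ bs′ ↭ x ∷ vertices w ++ ys
      perm = begin
        b ∷ a ∷ vertices w ++ x ∷ as′ ++ bs′   ↭⟨ prep b (prep a (shift x (vertices w) _)) ⟩
        b ∷ a ∷ x ∷ vertices w ++ as′ ++ bs′   ↭⟨ shifts (b ∷ a ∷ []) (x ∷ vertices w) ⟩
        x ∷ vertices w ++ b ∷ a ∷ as′ ++ bs′   ↭⟨ ++⁺ˡ (x ∷ vertices w) (prep b (++⁺ʳ bs′ (↭-sym τ))) ⟩
        x ∷ vertices w ++ b ∷ as ++ bs′        ↭⟨ ++⁺ˡ (x ∷ vertices w) (↭-sym (shift b as bs′)) ⟩
        x ∷ vertices w ++ as ++ b ∷ bs′        ↭⟨ ++⁺ˡ (x ∷ vertices w) (++⁺ˡ as (↭-sym υ)) ⟩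
        x ∷ vertices w ++ as ++ bs             ↭⟨ ++⁺ˡ (x ∷ vertices w) (↭-sym ρ) ⟩
        x ∷ vertices w ++ ys                   ∎

  -- Split the other vertices into in-neighbours and out-neighbours of `x`. Without an arc from an
  -- out-neighbour `b` to an in-neighbour `a`, the one-vertex path `x` is the middle of a split;
  -- with one, b → a → x → b is a triangle from which to grow.
  decompose : ∀ {N x xs} → 3 ≤ N → Unique (x ∷ xs) → CycleIn N (x ∷ xs) ⊎ Split N (x ∷ xs)
  decompose {N} {x} {xs} 3≤N distinct@(x∉ ∷ distinct′)
    with classify {E = λ _ → ⊥} {P = _⟶ x} {Q = x ⟶_} xs
           (λ {y} y∈ → inj₂ (tournament y x (All.lookup x∉ y∈ ∘ ≡.sym)))
  ... | inj₁ (_ , _ , () , _)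
  ... | inj₂ (as , bs , as→x , x→bs , ρ) with orient as (Unique-resp-↭ ρ distinct′)
  ... | inj₁ as⇒bs = inj₂ (split here (<-≤-trans (s≤s (s≤s z≤n)) 3≤N)
    (↭-trans (shift x as bs) (prep x (↭-sym ρ)))
    (λ { u∈ (here refl) → All.lookup as→x u∈ })
    (λ { (here refl) v∈ → All.lookup x→bs v∈ })
    as⇒bs)
  ... | inj₂ (a , b , as′ , bs′ , b→a , a∈ , b∈ , τ , υ) =
    grow distinct (N ∸ 3) (m∸n+n≡m 3≤N)
      (cycle (step b→a (step (All.lookup as→x a∈) here)) (All.lookup x→bs b∈))
      (as′ ++ bs′) perm
    where
    open PermutationReasoning
    perm : b ∷ a ∷ x ∷ as′ ++ bs′ ↭ x ∷ xs
    perm = begin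
      b ∷ a ∷ x ∷ as′ ++ bs′  ↭⟨ shift x (b ∷ a ∷ []) _ ⟩
      x ∷ b ∷ a ∷ as′ ++ bs′  ↭⟨ prep x (prep b (++⁺ʳ bs′ (↭-sym τ))) ⟩
      x ∷ b ∷ as ++ bs′       ↭⟨ prep x (↭-sym (shift b as bs′)) ⟩
      x ∷ as ++ b ∷ bs′       ↭⟨ prep x (++⁺ˡ as (↭-sym υ)) ⟩
      x ∷ as ++ bs            ↭⟨ prep x (↭-sym ρ) ⟩
      x ∷ xs                  ∎

  -- Sequences with arcs prescribed modulo ℓ.

  module Sequences (ℓ : ℕ) .{{_ : NonZero ℓ}} (3≤ℓ : 3 ≤ ℓ) where

    -- The arcs needed to place the vertices of H by their depth: along an arc of H between
    -- inner vertices the depth increases by 1 + q * ℓ.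
    Good : (ℕ → Fin k) → ℕ → Set
    Good w m = ∀ i q → suc i + q * ℓ < m → w i ⟶ w (suc i + q * ℓ)

    %-suc : ∀ i → suc i % ℓ ≡ suc (i % ℓ) % ℓ
    %-suc i = ≡.trans (cong (λ j → suc j % ℓ) (m≡m%n+[m/n]*n i ℓ))
      ([m+kn]%n≡m%n (suc (i % ℓ)) (i / ℓ) ℓ)

    suc-% : ∀ i → (suc (i % ℓ) < ℓ × suc i % ℓ ≡ suc (i % ℓ)) ⊎
                  (suc (i % ℓ) ≡ ℓ × suc i % ℓ ≡ 0)
    suc-% i with m≤n⇒m<n∨m≡n (m%n<n i ℓ)
    ... | inj₁ lt = inj₁ (lt , ≡.trans (%-suc i) (m<n⇒m%n≡m lt))
    ... | inj₂ eq = inj₂ (eq , ≡.trans (%-suc i) (≡.trans (cong (_% ℓ) eq) (n%n≡0 ℓ)))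

    suc-%-injective : ∀ i j → suc i % ℓ ≡ suc j % ℓ → i % ℓ ≡ j % ℓ
    suc-%-injective i j eq with suc-% i | suc-% j
    ... | inj₁ (_ , p) | inj₁ (_ , q) = suc-injective (≡.trans (≡.sym p) (≡.trans eq q))
    ... | inj₁ (_ , p) | inj₂ (_ , q) = contradiction (≡.trans (≡.sym p) (≡.trans eq q)) λ ()
    ... | inj₂ (_ , p) | inj₁ (_ , q) = contradiction (≡.trans (≡.sym p) (≡.trans eq q)) λ ()
    ... | inj₂ (p , _) | inj₂ (q , _) = suc-injective (≡.trans p (≡.sym q))

    -- Modulo ℓ, the target is the position right after `i`; when this wraps round, the walk being
    -- closed identifies positions ℓ and 0.
    periodic-good : ∀ {x m} (w : Walk T x x m) → m ≡ ℓ → ∀ i q →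
      at w (i % ℓ) ⟶ at w ((suc i + q * ℓ) % ℓ)
    periodic-good {x} w refl i q = subst (λ j → at w (i % ℓ) ⟶ at w j)
      (≡.sym ([m+kn]%n≡m%n (suc i) q ℓ)) next
      where
      next : at w (i % ℓ) ⟶ at w (suc i % ℓ)
      next with suc-% i
      ... | inj₁ (_ , eq)   rewrite eq = at-arc w (m%n<n i ℓ)
      ... | inj₂ (eq , eq′) rewrite eq′ = subst (at w (i % ℓ) ⟶_)
        (≡.trans (cong (at w) eq) (≡.trans (at-last w) (≡.sym (at-first w))))
        (at-arc w (m%n<n i ℓ))

    infixr 5 _≺[_]≻_
    _≺[_]≻_ : (ℕ → Fin k) → ℕ → (ℕ → Fin k) → ℕ → Fin k
    (v ≺[ m ]≻ w) i with i <? m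
    ... | yes _ = v i
    ... | no  _ = w (i ∸ m)

    join-< : ∀ v w {m i} → i < m → (v ≺[ m ]≻ w) i ≡ v i
    join-< v w {m} {i} i<m with i <? m
    ... | yes _   = refl
    ... | no  i≮m = contradiction i<m i≮m

    join-≥ : ∀ v w {m i} → m ≤ i → (v ≺[ m ]≻ w) i ≡ w (i ∸ m)
    join-≥ v w {m} {i} m≤i with i <? m
    ... | yes i<m = contradiction i<m (≤⇒≯ m≤i)
    ... | no  _   = refl

    private
      ∸-bound : ∀ {m n i} → m ≤ i → i < m + n → i ∸ m < n
      ∸-bound {m} {n} {i} m≤i i<m+n =
        +-cancelˡ-< m (i ∸ m) n (subst (_< m + n) (≡.sym (m+[n∸m]≡n m≤i)) i<m+n)

    -- Across the seam every arc is available. Beyond it both positions are shifted by `m`, which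
    -- preserves their difference.
    join-good : ∀ {v w m n} → Good v m → Good w n →
      (∀ {i j} → i < m → j < n → v i ⟶ w j) → Good (v ≺[ m ]≻ w) (m + n)
    join-good {v} {w} {m} {n} gv gw v⟶w i q j<m+n
      with suc i + q * ℓ <? m | i <? m
    ... | yes j<m | yes _   = gv i q j<m
    ... | yes j<m | no  i≮m = contradiction (<-trans (s≤s (m≤m+n i (q * ℓ))) j<m) i≮m
    ... | no  j≮m | yes i<m = v⟶w i<m (∸-bound (≮⇒≥ j≮m) j<m+n)
    ... | no  j≮m | no  i≮m = subst (λ j → w (i ∸ m) ⟶ w j) eq
      (gw (i ∸ m) q (subst (_< n) (≡.sym eq) (∸-bound (≮⇒≥ j≮m) j<m+n)))
      where
      eq : suc (i ∸ m) + q * ℓ ≡ suc i + q * ℓ ∸ m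
      eq = ≡.trans (cong (_+ q * ℓ) (≡.sym (+-∸-assoc 1 (≮⇒≥ i≮m))))
                   (≡.sym (+-∸-comm (q * ℓ) (≤-trans (≮⇒≥ i≮m) (n≤1+n i))))

    -- Members may repeat, as they do when a cycle is walked round several times.
    Sequence : List (Fin k) → Set
    Sequence xs = ∃ λ w → Good w (length xs) × (∀ {i} → i < length xs → w i ∈ xs)

    sequence-++ : ∀ {xs ys} → Sequence xs → Sequence ys → xs ⇒ ys → Sequence (xs ++ ys)
    sequence-++ {xs} {ys} (v , gv , v∈) (w , gw , w∈) xs⇒ys rewrite length-++ xs {ys} =
      v ≺[ length xs ]≻ w ,
      join-good gv gw (λ i< j< → xs⇒ys (v∈ i<) (w∈ j<)) ,
      member
      where
      member : ∀ {i} → i < length xs + length ys → (v ≺[ length xs ]≻ w) i ∈ xs ++ ys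
      member {i} i< with i <? length xs
      ... | yes i<m = ∈-++⁺ˡ (v∈ i<m)
      ... | no  i≮m = ∈-++⁺ʳ xs (w∈ (∸-bound (≮⇒≥ i≮m) i<))

    sequence-↭ : ∀ {xs ys} → xs ↭ ys → Sequence xs → Sequence ys
    sequence-↭ σ (w , gw , w∈) rewrite ↭-length σ = w , gw , ∈-resp-↭ σ ∘ w∈

    -- On fewer than ℓ positions only `q = 0` occurs, so the arcs of the path suffice.
    short-walk : ∀ {x z m} (w : Walk T x z m) → suc m < ℓ → Sequence (vertices w)
    short-walk {m = m} w m<ℓ rewrite length-vertices w = at w , good , λ {i} _ → at∈ w i
      where
      good : Good (at w) (suc m)
      good i zero    lt rewrite +-identityʳ i = at-arc w (≤-pred lt)
      good i (suc q) lt = contradiction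
        (<-trans (≤-<-trans (≤-trans (m≤m+n ℓ (q * ℓ)) (m≤n+m _ (suc i))) lt) m<ℓ) (n≮n ℓ)

    -- The argument v₀ is only a filler outside the range of the sequence.
    sequence : Fin k → ∀ xs → Acc _<_ (length xs) → Unique xs → Sequence xs
    sequence v₀ []       _         _        = (λ _ → v₀) , (λ _ _ ()) , λ ()
    sequence v₀ xs@(_ ∷ _) (acc rec) distinct with decompose 3≤ℓ distinct
    ... | inj₁ (m , c , eq , ys , σ) =
      (λ i → at closed (i % ℓ)) , (λ i q _ → periodic-good closed eq i q) ,
      λ {i} _ → ∈-resp-↭ σ (∈-++⁺ˡ (on-cycle (at∈ closed (i % ℓ))))
      where
      closed : Walk T (Cycle.first c) (Cycle.first c) (suc m)
      closed = snoc (path c) (closing c)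
      on-cycle : ∀ {y} → y ∈ vertices closed → y ∈ support c
      on-cycle y∈ with snoc∈ (path c) (closing c) y∈
      ... | inj₁ y∈c = y∈c
      ... | inj₂ refl = first∈ (path c)
    ... | inj₂ (split {as} {bs} {size = m} w short σ as⇒w w⇒bs as⇒bs) =
      sequence-↭ σ (sequence-++ {as} {vertices w ++ bs}
        (sequence v₀ as (rec as<) (++-uniqueˡ as distinct′))
        (sequence-++ (short-walk w short)
          (sequence v₀ bs (rec bs<) (++-uniqueʳ (vertices w) (++-uniqueʳ as distinct′))) w⇒bs)
        λ u∈ v∈ → [ as⇒w u∈ , as⇒bs u∈ ]′ (∈-++⁻ (vertices w) v∈))
      where
      distinct′ : Unique (as ++ vertices w ++ bs)
      distinct′ = Unique-resp-↭ (↭-sym σ) distinct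
      total : length as + (suc m + length bs) ≡ length xs
      total = ≡.trans (cong (λ l → length as + (l + length bs)) (≡.sym (length-vertices w)))
        (≡.trans (cong (length as +_) (≡.sym (length-++ (vertices w))))
          (≡.trans (≡.sym (length-++ as)) (↭-length σ)))
      -- The middle path has at least one vertex, so both recursive calls are on shorter lists.
      as< : length as < length xs
      as< = subst (length as <_) total (m<m+n (length as) z<s)
      bs< : length bs < length xs
      bs< = subst (length bs <_) total
        (<-≤-trans (s≤s (m≤n+m (length bs) m)) (m≤n+m (suc m + length bs) (length as)))

    -- Templates, and their construction from a split.

    -- r + s * ℓ stands for the length of a longest walk through an inner vertex of H, which
    -- goes to w at its depth; sources go to a and sinks to b.
    Template : ℕ → Fin k → Fin k → ℕ → Set
    Template N a b r = ∃ λ (w : ℕ → Fin k) → w 0 ≡ a × ∀ s → r + s * ℓ ≤ N → ∀ i q →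
      (suc i + q * ℓ < r + s * ℓ → w i ⟶ w (suc i + q * ℓ)) ×
      (suc i + q * ℓ ≡ r + s * ℓ → w i ⟶ b)

    -- The ends `a` and `b` are shared by all residues because a source or sink of H may be adjacent
    -- to inner vertices of different residues.
    Templates : ℕ → Set
    Templates N = ∃ λ a → ∃ λ b → a ⟶ b × ∀ r → r < ℓ → Template N a b r

    -- The member at the largest admissible position `r + S * ℓ` serves as `b`. A shorter length
    -- `r + s * ℓ` differs from it by a multiple of ℓ, so the arc to `b` is one that `Good` provides
    -- with a larger `q`.
    good-template : ∀ {N w r} S → (∀ s → r + s * ℓ ≤ N → s ≤ S) →
      Good w (suc (r + S * ℓ)) → Template N (w 0) (w (r + S * ℓ)) r
    good-template {N} {w} {r} S bound good = w , refl , λ s n≤N i q →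
      (λ lt → good i q (<-≤-trans lt (≤-trans (+-monoʳ-≤ r (*-monoˡ-≤ ℓ (bound s n≤N))) (n≤1+n _)))) ,
      λ eq → subst (λ j → w i ⟶ w j) (last i q s eq (bound s n≤N))
        (good i (q + (S ∸ s)) (s≤s (≤-reflexive (last i q s eq (bound s n≤N)))))
      where
      last : ∀ i q s → suc i + q * ℓ ≡ r + s * ℓ → s ≤ S →
        suc i + (q + (S ∸ s)) * ℓ ≡ r + S * ℓ
      last i q s eq s≤S = begin
        suc i + (q + (S ∸ s)) * ℓ     ≡⟨ distribute (suc i) q (S ∸ s) ℓ ⟩
        suc i + q * ℓ + (S ∸ s) * ℓ   ≡⟨ cong (_+ (S ∸ s) * ℓ) eq ⟩
        r + s * ℓ + (S ∸ s) * ℓ       ≡⟨ distribute r s (S ∸ s) ℓ ⟨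
        r + (s + (S ∸ s)) * ℓ         ≡⟨ cong (λ t → r + t * ℓ) (m+[n∸m]≡n s≤S) ⟩
        r + S * ℓ                     ∎
        where open ≡.≡-Reasoning

    -- A prefix of v followed by a suffix of w.
    good-of-length : ∀ {v w m n} → Good v (suc m) → Good w (suc n) →
      (∀ {i j} → i < suc m → j < suc n → v i ⟶ w j) →
      ∀ L → L ≤ m + n → ∃ λ x → Good x (suc (suc L)) × x 0 ≡ v 0 × x (suc L) ≡ w n
    good-of-length {v} {w} {m} {n} gv gw v⟶w L L≤ with L ≤? m
    ... | yes L≤m = v ≺[ suc L ]≻ const-end ,
      subst (Good _) (+-comm (suc L) 1) (join-good {n = 1}
        (λ i q lt → gv i q (≤-trans lt (s≤s L≤m)))
        (λ { i q (s≤s ()) })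
        (λ i< _ → v⟶w (≤-trans i< (s≤s L≤m)) ≤-refl)) ,
      join-< v const-end {m = suc L} z<s , join-≥ v const-end {m = suc L} ≤-refl
      where
      const-end : ℕ → Fin k
      const-end _ = w n
    -- All of `v` is used; `w` starts at `δ`, which leaves exactly its last `suc (L ∸ m)` members.
    ... | no L≰m = v ≺[ suc m ]≻ shifted ,
      subst (Good _) size (join-good gv good-shifted (λ i< j< → v⟶w i< (bound j<))) ,
      join-< v shifted {m = suc m} z<s ,
      ≡.trans (join-≥ v shifted {m = suc m} (s≤s (<⇒≤ m<L))) (cong w at-end)
      where
      m<L = ≰⇒> L≰m
      δ = n ∸ (L ∸ m)
      L∸m≤n : L ∸ m ≤ n
      L∸m≤n = ≤-trans (∸-monoˡ-≤ m L≤) (≤-reflexive (m+n∸m≡n m n))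
      shifted : ℕ → Fin k
      shifted i = w (i + δ)
      at-end : L ∸ m + δ ≡ n
      at-end = m+[n∸m]≡n L∸m≤n
      bound : ∀ {i} → i < suc (L ∸ m) → i + δ < suc n
      bound i< = <-≤-trans (+-monoˡ-< δ i<) (s≤s (≤-reflexive at-end))
      good-shifted : Good shifted (suc (L ∸ m))
      good-shifted i q lt = subst (λ j → w (i + δ) ⟶ w j) eq
        (gw (i + δ) q (subst (_< suc n) (≡.sym eq) (bound lt)))
        where
        ring : ∀ a b c → suc (a + b) + c ≡ suc a + c + b
        ring = solve-∀
        eq : suc (i + δ) + q * ℓ ≡ suc i + q * ℓ + δ
        eq = ring i δ (q * ℓ)
      size : suc m + suc (L ∸ m) ≡ suc (suc L)
      size = cong suc (≡.trans (+-suc m (L ∸ m)) (cong suc (m+[n∸m]≡n (<⇒≤ m<L))))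

    split-templates : ∀ {xs ys} → Sequence xs → Sequence ys → xs ⇒ ys →
      ∀ {m n} → length xs ≡ suc m → length ys ≡ suc n → Templates (suc (m + n))
    split-templates (v , gv , v∈) (w , gw , w∈) xs⇒ys {m} {n} eqx eqy
      rewrite eqx | eqy = v 0 , w n , v⟶w z<s ≤-refl , template
      where
      v⟶w : ∀ {i j} → i < suc m → j < suc n → v i ⟶ w j
      v⟶w i< j< = xs⇒ys (v∈ i<) (w∈ j<)
      N = suc (m + n)
      template : ∀ r → r < ℓ → Template N (v 0) (w n) r
      template r _ with r ≤? N
      -- No admissible length has this residue, so any filler will do.
      ... | no  r≰N = (λ _ → v 0) , refl , λ s n≤N →
        contradiction (≤-trans (m≤m+n r (s * ℓ)) n≤N) r≰N
      ... | yes r≤N = go (r + S * ℓ) refl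
        where
        S = (N ∸ r) / ℓ
        bound : ∀ s → r + s * ℓ ≤ N → s ≤ S
        bound s n≤N = subst (_≤ S) (m*n/n≡m s ℓ)
          (/-monoˡ-≤ ℓ (≤-trans (≤-reflexive (≡.sym (m+n∸m≡n r (s * ℓ)))) (∸-monoˡ-≤ r n≤N)))
        L≤N : r + S * ℓ ≤ N
        L≤N = ≤-trans (+-monoʳ-≤ r (m/n*n≤m (N ∸ r) ℓ)) (≤-reflexive (m+[n∸m]≡n r≤N))
        go : ∀ L → L ≡ r + S * ℓ → Template N (v 0) (w n) r
        go zero    eq = (λ _ → v 0) , refl , λ s n≤N i q →
          let r+sℓ≤0 = ≤-trans (+-monoʳ-≤ r (*-monoˡ-≤ ℓ (bound s n≤N))) (≤-reflexive (≡.sym eq)) in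
          (λ lt → contradiction (<-≤-trans lt r+sℓ≤0) λ ()) ,
          (λ e → contradiction (≤-trans (≤-reflexive e) r+sℓ≤0) λ ())
        go (suc L) eq
          with x , gx , x0 , xL ← good-of-length gv gw v⟶w L (≤-pred (≤-trans (≤-reflexive eq) L≤N)) =
          ≡.subst₂ (λ a b → Template N a b r) x0 (≡.trans (cong x (≡.sym eq)) xL)
            (good-template S bound (subst (Good x) (cong suc eq) gx))

    -- Templates from a 6-cycle.

    module _ (M : Matrix) (φ : Fin 6 → Fin k) (arc : ∀ u v → M u v ≡ true → φ u ⟶ φ v) where

      walk : ∀ n {Q u} → Reach M n Q u → ∃ λ v → Q v × Walk T (φ u) (φ v) n
      walk zero    q = _ , q , here
      walk (suc n) (_ , u→v , r) with walk n r
      ... | x , q , w = x , q , step (arc _ _ u→v) w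

      gadget-templates : Gadget M → ∀ N → Templates N
      gadget-templates (triangles , a , b , a→b ,
        l03 ∷ l12 ∷ l21 ∷ l04 ∷ l13 ∷ l22 ∷ l31 ∷ l05 ∷ l14 ∷ l23 ∷ l32 ∷ l41 ∷ []) N =
        φ a , φ b , arc a b a→b , template
        where
        Link : ℕ → ℕ → Set
        Link d e = ∃ λ x → ∃ λ y → φ a ⟶ φ x × y ⟶ φ b × Walk T (φ x) y d × Walk T y (φ x) e

        link : ∀ {d e} → Linked M a b (d , e) → Link d e
        link {d} {e} (x , a→x , r) with walk d r
        ... | y , (y→b , r′) , w with walk e r′
        ... | _ , refl , w′ = x , φ y , arc a x a→x , arc y b y→b , w , w′

        triangle : ∀ x → Walk T (φ x) (φ x) 3
        triangle x with walk 3 {x ≡_} (triangles x)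
        ... | _ , refl , w = w

        link+3ˡ : ∀ {d e} → Link d e → Link (3 + d) e
        link+3ˡ (x , y , a→x , y→b , w , w′) = x , y , a→x , y→b , triangle x ++ʷ w , w′

        link+3ʳ : ∀ {d e} → Link d e → Link d (3 + e)
        link+3ʳ {d} {e} (x , y , a→x , y→b , w , w′) =
          x , y , a→x , y→b , w , subst (Walk T y (φ x)) (+-comm e 3) (w′ ++ʷ triangle x)

        -- Triangles are removed from the side where the total stays at least 3, until one of the
        -- twelve pairs in `lengths` is reached.
        links : ∀ d e → 2 ≤ d + e → Link d (suc e)
        links 0 0 ()
        links 0 1 (s≤s ())
        links 0 2 _ = link l03
        links 0 3 _ = link l04
        links 0 4 _ = link l05
        links 0 (suc (suc (suc e@(suc (suc _))))) _ = link+3ʳ (links 0 e (s≤s (s≤s z≤n)))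
        links 1 0 (s≤s ())
        links 1 1 _ = link l12
        links 1 2 _ = link l13
        links 1 3 _ = link l14
        links 1 (suc (suc (suc e@(suc _)))) _ = link+3ʳ (links 1 e (s≤s (s≤s z≤n)))
        links 2 0 _ = link l21
        links 2 1 _ = link l22
        links 2 2 _ = link l23
        links 2 (suc (suc (suc e))) _ = link+3ʳ (links 2 e (s≤s (s≤s z≤n)))
        links 3 0 _ = link l31
        links 3 1 _ = link l32
        links 3 e@(suc (suc _)) _ = link+3ˡ (links 0 e (s≤s (s≤s z≤n)))
        links 4 0 _ = link l41
        links 4 e@(suc _) _ = link+3ˡ (links 1 e (s≤s (s≤s z≤n)))
        links (suc (suc (suc d@(suc (suc _))))) e _ = link+3ˡ (links d e (s≤s (s≤s z≤n)))

        -- Position 0 is taken by `a`, so position `suc i` has index `i` on the closed walk. The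
        -- positions ≡ r - 1, where the step to `b` is due, thus have index ≡ r - 2; `d` is this
        -- residue, which wraps round for r = 0 and r = 1.
        offset : ∀ r → r < ℓ → ∃ λ d → ∃ λ e → d + suc e ≡ ℓ × suc (suc d) % ℓ ≡ r
        offset 0 _ = ℓ ∸ 2 , 1 , m∸n+n≡m 2≤ℓ , ≡.trans (cong (_% ℓ) (m+[n∸m]≡n 2≤ℓ)) (n%n≡0 ℓ)
          where 2≤ℓ = ≤-trans (n≤1+n 2) 3≤ℓ
        offset 1 1<ℓ = ℓ ∸ 1 , 0 , m∸n+n≡m (<⇒≤ 1<ℓ) ,
          ≡.trans (cong (λ l → suc l % ℓ) (m+[n∸m]≡n (<⇒≤ 1<ℓ)))
            (≡.trans ([m+n]%n≡m%n 1 ℓ) (m<n⇒m%n≡m 1<ℓ))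
        offset (suc (suc d)) r<ℓ = d , ℓ ∸ suc d ,
          ≡.trans (+-suc d _) (m+[n∸m]≡n (≤-trans (n≤1+n _) (<⇒≤ r<ℓ))) , m<n⇒m%n≡m r<ℓ

        template : ∀ r → r < ℓ → Template N (φ a) (φ b) r
        template r r<ℓ with offset r r<ℓ
        ... | d , e , d+e≡ℓ , 2+d≡r
          with links d e (≤-pred (≤-trans 3≤ℓ (≤-reflexive (≡.trans (≡.sym d+e≡ℓ) (+-suc d e)))))
        ... | x , y , a→x , y→b , w , w′ = f , refl , λ s _ i q → next i q , last i q s
          where
          closed = w ++ʷ w′
          f : ℕ → Fin k
          f zero    = φ a
          f (suc i) = at closed (i % ℓ)
          next : ∀ {n} i q → suc i + q * ℓ < n → f i ⟶ f (suc i + q * ℓ)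
          next zero    q _ = subst (φ a ⟶_)
            (≡.trans (≡.sym (at-first closed))
              (cong (at closed) (≡.sym (m*n%n≡0 q ℓ))))
            a→x
          next (suc i) q _ = periodic-good closed d+e≡ℓ i q
          last : ∀ i q s → suc i + q * ℓ ≡ r + s * ℓ → f i ⟶ φ b
          last zero    q s _  = arc a b a→b
          last (suc i) q s eq = subst (_⟶ φ b)
            (≡.trans (≡.sym (at-join w w′)) (cong (at closed) (≡.sym i≡d))) y→b
            where
            i≡d : i % ℓ ≡ d
            i≡d = ≡.trans (suc-%-injective i d (suc-%-injective (suc i) (suc d)
              (begin
                suc (suc i) % ℓ            ≡⟨ [m+kn]%n≡m%n (suc (suc i)) q ℓ ⟨
                (suc (suc i) + q * ℓ) % ℓ  ≡⟨ cong (_% ℓ) eq ⟩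
                (r + s * ℓ) % ℓ            ≡⟨ [m+kn]%n≡m%n r s ℓ ⟩
                r % ℓ                      ≡⟨ m<n⇒m%n≡m r<ℓ ⟩
                r                          ≡⟨ 2+d≡r ⟨
                suc (suc d) % ℓ            ∎)))
              (m<n⇒m%n≡m (≤-trans (m<m+n d z<s) (≤-reflexive d+e≡ℓ)))
              where open ≡.≡-Reasoning

    ¬adj⇒⟶ : ∀ {u v} → u ≢ v → not (adj T u v) ≡ true → v ⟶ u
    ¬adj⇒⟶ {u} {v} u≢v eq with tournament u v u≢v
    ... | inj₂ v→u = v→u
    ... | inj₁ u→v rewrite u→v = case eq of λ ()

    hexagon-templates : (c : Cycle 5) → Unique (support c) → ∀ N → Templates N
    hexagon-templates
      (cycle (step {a} a→b (step {b} b→c (step {c} c→d (step {d} d→e (step {e} e→f (here {f})))))) f→a)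
      ((_ ∷ a≢c ∷ a≢d ∷ a≢e ∷ _ ∷ []) ∷ (_ ∷ b≢d ∷ b≢e ∷ b≢f ∷ []) ∷
       (_ ∷ c≢e ∷ c≢f ∷ []) ∷ (_ ∷ d≢f ∷ []) ∷ _) =
      gadget-templates (matrix chords) φ arc (gadget chords)
      where
      φ : Fin 6 → Fin k
      φ 0F = a
      φ 1F = b
      φ 2F = c
      φ 3F = d
      φ 4F = e
      φ 5F = f
      chords : Vec Bool 9
      chords = adj T a c ∷ adj T a d ∷ adj T a e ∷ adj T b d ∷ adj T b e ∷ adj T b f
             ∷ adj T c e ∷ adj T c f ∷ adj T d f ∷ []
      arc : ∀ u v → matrix chords u v ≡ true → φ u ⟶ φ v
      arc 0F 0F ()
      arc 0F 1F _ = a→b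
      arc 0F 2F p = p
      arc 0F 3F p = p
      arc 0F 4F p = p
      arc 0F 5F ()
      arc 1F 0F ()
      arc 1F 1F ()
      arc 1F 2F _ = b→c
      arc 1F 3F p = p
      arc 1F 4F p = p
      arc 1F 5F p = p
      arc 2F 0F p = ¬adj⇒⟶ a≢c p
      arc 2F 1F ()
      arc 2F 2F ()
      arc 2F 3F _ = c→d
      arc 2F 4F p = p
      arc 2F 5F p = p
      arc 3F 0F p = ¬adj⇒⟶ a≢d p
      arc 3F 1F p = ¬adj⇒⟶ b≢d p
      arc 3F 2F ()
      arc 3F 3F ()
      arc 3F 4F _ = d→e
      arc 3F 5F p = p
      arc 4F 0F p = ¬adj⇒⟶ a≢e p
      arc 4F 1F p = ¬adj⇒⟶ b≢e p
      arc 4F 2F p = ¬adj⇒⟶ c≢e p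
      arc 4F 3F ()
      arc 4F 4F ()
      arc 4F 5F _ = e→f
      arc 5F 0F _ = f→a
      arc 5F 1F p = ¬adj⇒⟶ b≢f p
      arc 5F 2F p = ¬adj⇒⟶ c≢f p
      arc 5F 3F p = ¬adj⇒⟶ d≢f p
      arc 5F 4F ()
      arc 5F 5F ()

-- Templates in every tournament on at least six vertices.

module _ {k} (T : OrientedGraph (suc k)) (tournament : IsTournament T)
  (ℓ : ℕ) .{{_ : NonZero ℓ}} (3≤ℓ : 3 ≤ ℓ) where
  open Tournament T tournament
  open Sequences ℓ 3≤ℓ

  private
    sequence! : ∀ xs → Unique xs → Sequence xs
    sequence! xs = sequence 0F xs (<-wellFounded _)

  templates : 6 ≤ suc k → Templates k
  templates 6≤k with decompose {N = 6} (s≤s (s≤s (s≤s z≤n))) (allFin⁺ (suc k))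
  ... | inj₁ (_ , c , refl , ys , σ) = hexagon-templates c
    (++-uniqueˡ (Cycle.support c) (Unique-resp-↭ (↭-sym σ) (allFin⁺ (suc k)))) k
  ... | inj₂ (split {as} {bs} {size = m} w short σ as⇒w w⇒bs as⇒bs) =
    by-cases as bs refl refl
    where
    distinct : Unique (as ++ vertices w ++ bs)
    distinct = Unique-resp-↭ (↭-sym σ) (allFin⁺ (suc k))
    distinct-w++bs : Unique (vertices w ++ bs)
    distinct-w++bs = ++-uniqueʳ as distinct
    w++bs : ∀ bs → length (vertices w ++ bs) ≡ suc (m + length bs)
    w++bs bs = ≡.trans (length-++ (vertices w)) (cong (_+ length bs) (length-vertices w))
    total : length as + suc (m + length bs) ≡ suc k
    total = ≡.trans (cong (length as +_) (≡.sym (w++bs bs)))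
      (≡.trans (≡.sym (length-++ as)) (≡.trans (↭-length σ) (length-tabulate id)))
    resize : ∀ i j → suc i + suc j ≡ suc k → Templates (suc (i + j)) → Templates k
    resize i j eq = subst Templates (≡.trans (≡.sym (+-suc i j)) (suc-injective eq))
    by-cases : ∀ as′ bs′ → as ≡ as′ → bs ≡ bs′ → Templates k
    by-cases (a ∷ as′) _ refl _ = resize (length as′) (m + length bs) total
      (split-templates (sequence! as (++-uniqueˡ as distinct)) (sequence! _ distinct-w++bs)
        (λ u∈ v∈ → [ as⇒w u∈ , as⇒bs u∈ ]′ (∈-++⁻ (vertices w) v∈)) refl (w++bs bs))
    by-cases [] (b ∷ bs′) refl refl = resize m (length bs′) total
      (split-templates (sequence! _ (++-uniqueˡ (vertices w) distinct-w++bs))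
        (sequence! bs (++-uniqueʳ (vertices w) distinct-w++bs)) w⇒bs (length-vertices w) refl)
    -- A middle path on fewer than six vertices cannot be the whole tournament.
    by-cases [] [] refl refl = contradiction (≤-trans 6≤k
      (≤-reflexive (≡.trans (≡.sym total) (cong suc (+-identityʳ m))))) (<⇒≱ short)

-- Depth and height in a layered graph.

module Layering {n} (H : OrientedGraph n) (acyclic : Acyclic H)
  {ℓ : ℕ} .{{_ : NonZero ℓ}} (layered : Layered ℓ H)
  {N : ℕ} (bounded : ∀ {u v m} → Walk H u v m → m ≤ N) where

  private
    deepest : ∀ v → ∃ λ m → (∃ λ u → Walk H u v m) ×
      (∀ {i} → i ≤ N → (∃ λ u → Walk H u v i) → i ≤ m)
    deepest v = maximum (λ m → any? λ u → walk? u v m) (v , here) N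

    highest : ∀ v → ∃ λ m → (∃ λ u → Walk H v u m) ×
      (∀ {i} → i ≤ N → (∃ λ u → Walk H v u i) → i ≤ m)
    highest v = maximum (λ m → any? λ u → walk? v u m) (v , here) N

  depth height : Fin n → ℕ
  depth  v = proj₁ (deepest v)
  height v = proj₁ (highest v)

  depth-max : ∀ {u v m} → Walk H u v m → m ≤ depth v
  depth-max {v = v} w = proj₂ (proj₂ (deepest v)) (bounded w) (_ , w)

  height-max : ∀ {u v m} → Walk H u v m → m ≤ height u
  height-max {u = u} w = proj₂ (proj₂ (highest u)) (bounded w) (_ , w)

  -- A longest walk into `v` cannot be prolonged backwards. Starting at a source, it is subject to
  -- the layering condition.
  from-source : ∀ v → ∃ λ s → IsSource H s × Walk H s v (depth v)
  from-source v with proj₁ (proj₂ (deepest v))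
  ... | s , w = s , (λ u a → contradiction (depth-max (step a w)) (n≮n _)) , w

  to-sink : ∀ v → ∃ λ t → IsSink H t × Walk H v t (height v)
  to-sink v with proj₁ (proj₂ (highest v))
  ... | t , w = t , (λ u a → contradiction (height-max (snoc w a)) (n≮n _)) , w

  source-depth : ∀ {v} → IsSource H v → depth v ≡ 0
  source-depth {v} source with depth v | proj₁ (proj₂ (deepest v))
  ... | zero  | _     = refl
  ... | suc m | u , w = contradiction w (no-walk source)
    where
    no-walk : ∀ {u v m} → IsSource H v → ¬ Walk H u v (suc m)
    no-walk source (step a here)         = source _ a
    no-walk source (step _ w@(step _ _)) = no-walk source w

  sink-height : ∀ {v} → IsSink H v → height v ≡ 0
  sink-height {v} sink with height v | proj₁ (proj₂ (highest v))
  ... | zero  | _              = refl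
  ... | suc m | u , step a _   = contradiction a (sink _)

  depth+height≤ : ∀ v → depth v + height v ≤ N
  depth+height≤ v = bounded (proj₂ (proj₂ (from-source v)) ++ʷ proj₂ (proj₂ (to-sink v)))

  Inner : Fin n → Set
  Inner v = ¬ IsSource H v × ¬ IsSink H v

  -- A longest walk into `u` prolonged by the arc and a longest walk into `v` both lead from sources
  -- to `v`, so their lengths agree modulo ℓ.
  depth-arc : ∀ {u v} → Inner v → Arc H u v → ∃ λ q → depth v ≡ suc (depth u) + q * ℓ
  depth-arc {u} {v} (¬source , ¬sink) a
    with i , j , ins , _ ← layered v ¬source ¬sink
       | s , s-source , w ← from-source u | t , t-source , w′ ← from-source v =
    CongMod-diff {i = i} (ins s _ s-source (dpath acyclic (snoc w a)))
      (ins t _ t-source (dpath acyclic w′)) (depth-max (snoc w a))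

  height-arc : ∀ {u v} → Inner u → Arc H u v → ∃ λ q → height u ≡ suc (height v) + q * ℓ
  height-arc {u} {v} (¬source , ¬sink) a
    with i , j , _ , outs ← layered u ¬source ¬sink
       | s , s-sink , w ← to-sink v | t , t-sink , w′ ← to-sink u =
    CongMod-diff {i = j} (outs s _ s-sink (dpath acyclic (step a w)))
      (outs t _ t-sink (dpath acyclic w′)) (height-max (step a w))

  -- This residue selects the template of an inner vertex. Along an arc between inner vertices the
  -- depth gains 1 and the height loses 1 modulo ℓ, so both use the same template.
  class : Fin n → ℕ
  class v = (depth v + height v) % ℓ

  class-arc : ∀ {u v} → Inner u → Inner v → Arc H u v → class u ≡ class v
  class-arc {u} {v} iu iv a with depth-arc iv a | height-arc iu a
  ... | q , eq | r , eq′ rewrite eq | eq′ = begin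
    (depth u + (suc (height v) + r * ℓ)) % ℓ ≡⟨ cong (_% ℓ) (ring₁ (depth u) (height v) (r * ℓ)) ⟩
    (suc (depth u + height v) + r * ℓ) % ℓ   ≡⟨ [m+kn]%n≡m%n _ r ℓ ⟩
    suc (depth u + height v) % ℓ             ≡⟨ [m+kn]%n≡m%n _ q ℓ ⟨
    (suc (depth u + height v) + q * ℓ) % ℓ   ≡⟨ cong (_% ℓ) (ring₂ (depth u) (height v) (q * ℓ)) ⟩
    (suc (depth u) + q * ℓ + height v) % ℓ   ∎
    where
    open ≡.≡-Reasoning
    ring₁ : ∀ a b c → a + (suc b + c) ≡ suc (a + b) + c
    ring₁ = solve-∀
    ring₂ : ∀ a b c → suc (a + b) + c ≡ suc a + c + b
    ring₂ = solve-∀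

  source? : ∀ v → Dec (IsSource H v)
  source? v = map′ (λ none u a → none (u , a)) (λ source (u , a) → source u a)
    (¬? (any? λ u → adj H u v Bool.≟ true))

  sink? : ∀ v → Dec (IsSink H v)
  sink? v = map′ (λ none u a → none (u , a)) (λ sink (u , a) → sink u a)
    (¬? (any? λ u → adj H v u Bool.≟ true))

  0<height : ∀ {v} → ¬ IsSink H v → 0 < height v
  0<height {v} ¬sink with any? (λ u → adj H v u Bool.≟ true)
  ... | yes (u , a) = height-max (step a here)
  ... | no  none    = contradiction (λ u a → none (u , a)) ¬sink

  -- The homomorphism defined by the templates.

  module _ {k} {T : OrientedGraph k} (tournament : IsTournament T) (3≤ℓ : 3 ≤ ℓ) where
    open Tournament.Sequences T tournament ℓ 3≤ℓ

    homomorphism : Templates N → ∃ (IsHom H T)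
    homomorphism (a , b , a→b , template) = f , hom
      where
      w : Fin n → ℕ → Fin k
      w v = proj₁ (template (class v) (m%n<n _ ℓ))
      w-0 : ∀ v → w v 0 ≡ a
      w-0 v = proj₁ (proj₂ (template (class v) (m%n<n _ ℓ)))
      divide : ∀ v → depth v + height v ≡ class v + (depth v + height v) / ℓ * ℓ
      divide v = m≡m%n+[m/n]*n (depth v + height v) ℓ
      w-arcs : ∀ v i q →
        (suc i + q * ℓ < depth v + height v → Arc T (w v i) (w v (suc i + q * ℓ))) ×
        (suc i + q * ℓ ≡ depth v + height v → Arc T (w v i) b)
      w-arcs v i q = (λ lt → proj₁ arcs (subst (suc i + q * ℓ <_) (divide v) lt)) ,
                     (λ eq → proj₂ arcs (≡.trans eq (divide v)))
        where arcs = proj₂ (proj₂ (template (class v) (m%n<n _ ℓ)))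
                ((depth v + height v) / ℓ) (subst (_≤ N) (divide v) (depth+height≤ v)) i q

      f : Fin n → Fin k
      -- An isolated vertex is both source and sink, and goes to `a`.
      f v with source? v | sink? v
      ... | yes _ | _     = a
      ... | no  _ | yes _ = b
      ... | no  _ | no  _ = w v (depth v)

      -- `template` also takes a proof of the bound on the residue; irrelevance of such proofs makes
      -- its value depend on the residue alone.
      w-class : ∀ {u v} → class u ≡ class v → ∀ i → w u i ≡ w v i
      w-class eq i = helper eq (m%n<n _ ℓ) (m%n<n _ ℓ)
        where
        helper : ∀ {r s} → r ≡ s → (p : r < ℓ) (q : s < ℓ) →
          proj₁ (template r p) i ≡ proj₁ (template s q) i
        helper refl p q = cong (λ p → proj₁ (template _ p) i) (≤-irrelevant p q)

      next : ∀ {u v} → Inner v → Arc H u v → Arc T (w v (depth u)) (w v (depth v))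
      next {u} {v} inner@(_ , ¬sink) uv with depth-arc inner uv
      ... | q , eq = subst (λ j → Arc T (w v (depth u)) (w v j)) (≡.sym eq)
        (proj₁ (w-arcs v (depth u) q)
          -- As `v` is no sink, its height is positive and its depth lies strictly below the final
          -- position.
          (subst (_< depth v + height v) eq (m<m+n (depth v) (0<height ¬sink))))

      hom : IsHom H T f
      hom u v uv with source? u | sink? u | source? v | sink? v
      ... | _          | _          | yes source | _        = contradiction uv (source u)
      ... | _          | yes sink   | _          | _        = contradiction uv (sink v)
      ... | yes _      | no _       | no _       | yes _    = a→b
      ... | yes source | no _       | no ¬source | no ¬sink =
        subst (λ x → Arc T x (w v (depth v)))
          (≡.trans (cong (w v) (source-depth source)) (w-0 v)) (next (¬source , ¬sink) uv)
      ... | no ¬source | no ¬sink   | no ¬source′ | no ¬sink′ =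
        subst (λ x → Arc T x (w v (depth v)))
          (≡.sym (w-class (class-arc (¬source , ¬sink) (¬source′ , ¬sink′) uv) (depth u)))
          (next (¬source′ , ¬sink′) uv)
      -- A sink has height 0, so `u` has height ≡ 1 modulo ℓ: its depth is a position from which the
      -- template steps to `b`.
      ... | no ¬source | no ¬sink   | no _       | yes sink
        with q , eq ← height-arc (¬source , ¬sink) uv =
        proj₂ (w-arcs u (depth u) q) (≡.sym (begin
          depth u + height u                 ≡⟨ cong (depth u +_) eq ⟩
          depth u + suc (height v + q * ℓ)   ≡⟨ cong (λ h → depth u + suc (h + q * ℓ)) (sink-height sink) ⟩
          depth u + suc (q * ℓ)              ≡⟨ +-suc (depth u) (q * ℓ) ⟩
          suc (depth u) + q * ℓ              ∎))
        where open ≡.≡-Reasoning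

-- Transitive tournaments and the lower bound.

<ᵇ-true⇒< : ∀ {i j} → (i <ᵇ j) ≡ true → i < j
<ᵇ-true⇒< {i} {j} = <ᵇ⇒< i j ∘ Equivalence.from T-≡

transitive : ∀ k → OrientedGraph k
transitive k = record
  { adj     = λ u v → toℕ u <ᵇ toℕ v
  ; noLoop  = λ v → dec-false (toℕ v <? toℕ v) (n≮n (toℕ v))
  ; antisym = λ u v u<v → dec-false (toℕ v <? toℕ u) λ v<u →
      n≮n (toℕ u) (<-trans (<ᵇ-true⇒< u<v) v<u)
  }

transitive-tournament : ∀ k → IsTournament (transitive k)
transitive-tournament k u v u≢v with <-cmp (toℕ u) (toℕ v)
... | tri< u<v _ _ = inj₁ (dec-true (toℕ u <? toℕ v) u<v)
... | tri≈ _ u≡v _ = contradiction (toℕ-injective u≡v) u≢v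
... | tri> _ _ v<u = inj₂ (dec-true (toℕ v <? toℕ u) v<u)

hom-transitive : ∀ {n k} {H : OrientedGraph n} {f : Fin n → Fin k} → IsHom H (transitive k) f →
  ∀ {u v m} → Walk H u v m → toℕ (f u) + m ≤ toℕ (f v)
hom-transitive _ here = ≤-reflexive (+-identityʳ _)
hom-transitive {f = f} hom (step {u} {x} {m = m} a w) =
  ≤-trans (≤-reflexive (+-suc (toℕ (f u)) m))
  (≤-trans (+-monoˡ-≤ m (<ᵇ-true⇒< (hom u x a))) (hom-transitive {f = f} hom w))

theorem23 : (ℓ : ℕ) → 3 ≤ ℓ → (n : ℕ) (H : OrientedGraph n) →
    Acyclic H → Layered ℓ H → (p : ℕ) → IsMaxPathOrder H p → 6 ≤ p →
    IsCompressibility H p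
theorem23 ℓ@(suc _) 3≤ℓ n H acyclic layered (suc N) ((_ , _ , m , path , eq) , max) 6≤p =
  receives , refuses
  where
  receives : AllTournamentsReceive H (suc N)
  receives T tournament =
    Layering.homomorphism H acyclic {ℓ} layered {N}
      (λ w → ≤-pred (max _ _ _ (dpath acyclic w)))
      {T = T} tournament 3≤ℓ (templates T tournament ℓ 3≤ℓ 6≤p)
  refuses : ∀ k → k < suc N → ¬ AllTournamentsReceive H k
  refuses k k<p all with f , hom ← all (transitive k) (transitive-tournament k) =
    -- A path with `m` arcs would end at a vertex numbered at least `m`, but the numbers stay below
    -- `k`, and `k ≤ m`.
    contradiction (≤-trans (m≤n+m m _) (hom-transitive {f = f} hom (DPath.walk path)))
      (<⇒≱ (<-≤-trans (toℕ<n _) (≤-trans (≤-pred k<p) (≤-reflexive (≡.sym (suc-injective eq))))))
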